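{- Let $G_1,G_2,\ldots,G_n$ ($n\ge 1$) be a finite sequence of pairwise disjoint connected graphs and let $x_i,y_i\in V(G_i)$ for $i=1,\ldots,n$. Let $C(G_1,\ldots,G_n)$ be the chain of the graphs $\{G_i\}_{i=1}^n$ with respect to the vertices $\{x_i,y_i\}_{i=1}^n$, i.e. the graph obtained from the disjoint union of $G_1,\ldots,G_n$ by identifying the vertex $y_i$ with the vertex $x_{i+1}$ for $i=1,2,\ldots,n-1$. Then $$\left(\sum_{i=1}^{n}\gamma_{sp}(G_i)\right)-n\leq \gamma_{sp}(C(G_1,\ldots,G_n))\leq \sum_{i=1}^{n}\gamma_{sp}(G_i).$$
   Context: All graphs are finite, simple and undirected. $N(v)$ denotes the open neighbourhood of $v$. For a graph $G=(V,E)$ and $S\subseteq V$ write $\overline{S}=V\setminus S$. A set $S\subseteq V$ is dominating if every vertex of $\overline{S}$ is adjacent to at least one vertex of $S$. A dominating set $S$ is a super dominating set of $G$ if for every $u\in\overline{S}$ there exists $w\in S$ with $N(w)\cap\overline{S}=\{u\}$. The super domination number $\gamma_{sp}(G)$ is the minimum cardinality of a super dominating set of $G$. -}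

module Defs where

open import Level using (0ℓ)
open import Data.Nat.Base as ℕ using (ℕ; zero; suc; _≤_; _<_; NonZero)
import Data.Nat.Properties as ℕ
open import Data.Nat.Induction using (<-wellFounded)
open import Data.Fin.Base using (Fin; zero; suc; toℕ; _↑ˡ_; _↑ʳ_; punchIn; punchOut; splitAt; join)
import Data.Fin.Properties as Fin
open import Data.Fin.Subset using (Subset; _∈_; _∉_; _∩_; ∁; ⁅_⁆; ⊤; ∣_∣)
open import Data.Fin.Subset.Properties using (_∈?_; ∈⊤; anySubset?)
open import Data.Bool.Properties using () renaming (_≟_ to _≟ᵇ_)
open import Data.Vec.Base using (tabulate)
open import Data.Vec.Properties using (≡-dec)
open import Data.Product.Base using (Σ-syntax; ∃-syntax; _×_; _,_; proj₁; proj₂)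
open import Data.Sum.Base using (inj₁; inj₂)
open import Function.Base using (_∘_; id)
open import Function.Bundles using (_⇔_; mk⇔; Equivalence)
open import Function.Definitions using (StrictlySurjective)
open import Induction.WellFounded using (Acc; acc)
open import Relation.Binary.Core using (Rel)
open import Relation.Binary.Definitions using (Decidable; Symmetric; Irreflexive)
open import Relation.Binary.Construct.Closure.Equivalence as EqC using (EqClosure)
open import Relation.Binary.Construct.Closure.ReflexiveTransitive using (Star; ε; _◅◅_)
open import Relation.Binary.PropositionalEquality
open import Relation.Nullary using (yes; no; does; contradiction)
open import Relation.Nullary.Decidable using (_×-dec_; _→-dec_; ¬?)
import Relation.Unary as U

open import Algebra.Properties.CommutativeMonoid.Sum ℕ.+-0-commutativeMonoid public
  using (sum-syntax)

------------------------------------------------------------------------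
-- Graphs

-- A finite vertex set is taken to be Fin order.  Adjacency is decidable,
-- so that neighbourhoods are (decidable) subsets of the vertex set.

record Graph : Set₁ where
  field
    order      : ℕ
    Adj        : Rel (Fin order) 0ℓ
    adj?       : Decidable Adj
    adj-sym    : Symmetric Adj
    adj-irrefl : Irreflexive _≡_ Adj

  Vertex : Set
  Vertex = Fin order

  N : Vertex → Subset order
  N v = tabulate (λ u → does (adj? v u))

open Graph public using (Vertex)

Connected : Graph → Set
Connected G = ∀ u v → Star (Graph.Adj G) u v

------------------------------------------------------------------------
-- Super domination

module _ (G : Graph) where
  open Graph G hiding (Vertex)

  Dominating : Subset order → Set
  Dominating S = ∀ u → u ∉ S → ∃[ w ] w ∈ S × Adj u w

  SuperDominating : Subset order → Set
  SuperDominating S =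
    Dominating S × (∀ u → u ∉ S → ∃[ w ] w ∈ S × N w ∩ ∁ S ≡ ⁅ u ⁆)

  superDominating? : U.Decidable SuperDominating
  superDominating? S =
    Fin.all? (λ u → ¬? (u ∈? S) →-dec
      Fin.any? (λ w → (w ∈? S) ×-dec adj? u w))
    ×-dec
    Fin.all? (λ u → ¬? (u ∈? S) →-dec
      Fin.any? (λ w → (w ∈? S) ×-dec ≡-dec _≟ᵇ_ (N w ∩ ∁ S) ⁅ u ⁆))

  ⊤-superDominating : SuperDominating ⊤
  ⊤-superDominating = (λ _ u∉⊤ → contradiction ∈⊤ u∉⊤) , (λ _ u∉⊤ → contradiction ∈⊤ u∉⊤)

IsMinCardinality : ∀ {n} → (Subset n → Set) → ℕ → Set
IsMinCardinality P k = (∃[ S ] P S × ∣ S ∣ ≡ k) × (∀ S → P S → k ≤ ∣ S ∣)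

minCardinality : ∀ {n} {P : Subset n → Set} → U.Decidable P →
                 ∃[ S ] P S → ∃[ k ] IsMinCardinality P k
minCardinality {P = P} P? (S , pS) = go S pS (<-wellFounded ∣ S ∣)
  where
  go : ∀ S → P S → Acc _<_ ∣ S ∣ → ∃[ k ] IsMinCardinality P k
  go S pS (acc rec) with anySubset? (λ T → P? T ×-dec (∣ T ∣ ℕ.<? ∣ S ∣))
  ... | yes (T , pT , T<S) = go T pT (rec T<S)
  ... | no  none           =
    ∣ S ∣ , (S , pS , refl) , λ T pT → ℕ.≮⇒≥ λ T<S → none (T , pT , T<S)

γsp-exists : ∀ G → ∃[ k ] IsMinCardinality (SuperDominating G) k
γsp-exists G = minCardinality (superDominating? G) (⊤ , ⊤-superDominating G)

γsp : Graph → ℕ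
γsp G = proj₁ (γsp-exists G)

γsp-isMinimum : ∀ G → IsMinCardinality (SuperDominating G) (γsp G)
γsp-isMinimum G = proj₂ (γsp-exists G)

------------------------------------------------------------------------
-- Chains

⨆ : ∀ {n} → (Fin n → ℕ) → Set
⨆ s = Σ[ i ∈ Fin _ ] Fin (s i)

data Glue {n} {s : Fin n → ℕ} (x y : ∀ i → Fin (s i)) : Rel (⨆ s) 0ℓ where
  glue : ∀ {i j} → toℕ j ≡ suc (toℕ i) → Glue x y (i , y i) (j , x j)

-- The chain is determined up to isomorphism: its vertex set is the
-- quotient of the disjoint union of the vertex sets by the equivalence
-- relation generated by Glue, and its edges are exactly the images of the
-- edges of the G i.  The vertices x i and y i may coincide, in which case
-- more than two vertices get identified with each other.

record IsChain {n} (G : Fin n → Graph) (x y : ∀ i → Vertex (G i)) (C : Graph) : Set where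
  field
    π            : ⨆ (Graph.order ∘ G) → Vertex C
    π-surjective : StrictlySurjective _≡_ π
    π-kernel     : ∀ p q → π p ≡ π q ⇔ EqClosure (Glue x y) p q
    π-adj        : ∀ c d → Graph.Adj C c d ⇔
                   (∃[ i ] ∃[ u ] ∃[ v ] Graph.Adj (G i) u v × π (i , u) ≡ c × π (i , v) ≡ d)

------------------------------------------------------------------------
-- Every sequence of graphs has a chain

private
  record Quotient {n} {s : Fin n → ℕ} (x y : ∀ i → Fin (s i)) : Set where
    field
      size       : ℕ
      π          : ⨆ s → Fin size
      surjective : StrictlySurjective _≡_ π
      kernel     : ∀ p q → π p ≡ π q ⇔ EqClosure (Glue x y) p q
      injective  : ∀ i u v → π (i , u) ≡ π (i , v) → u ≡ v

  record Wedge {m k} (a : Fin m) (b : Fin k) : Set₁ where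
    field
      size  : ℕ
      l     : Fin m → Fin size
      r     : Fin k → Fin size
      l-inj : ∀ {u v} → l u ≡ l v → u ≡ v
      r-inj : ∀ {u v} → r u ≡ r v → u ≡ v
      meet  : l a ≡ r b
      meet⁻ : ∀ {u v} → l u ≡ r v → u ≡ a × v ≡ b
      cover : ∀ (P : Fin size → Set) → (∀ u → P (l u)) → (∀ v → P (r v)) → ∀ c → P c

  wedge : ∀ {m k} (a : Fin m) (b : Fin k) → Wedge a b
  wedge {m} {suc k} a b = record
    { size = m ℕ.+ k ; l = _↑ˡ k ; r = r
    ; l-inj = Fin.↑ˡ-injective k _ _ ; r-inj = r-inj _ _
    ; meet = meet ; meet⁻ = meet⁻ _ _ ; cover = cover }
    where
    disj : ∀ {u : Fin m} {v : Fin k} → u ↑ˡ k ≢ m ↑ʳ v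
    disj {u} {v} eq with trans (sym (Fin.splitAt-↑ˡ m u k))
                          (trans (cong (splitAt m) eq) (Fin.splitAt-↑ʳ m k v))
    ... | ()

    r : Fin (suc k) → Fin (m ℕ.+ k)
    r v with b Fin.≟ v
    ... | yes _   = a ↑ˡ k
    ... | no  b≢v = m ↑ʳ punchOut b≢v

    r-inj : ∀ u v → r u ≡ r v → u ≡ v
    r-inj u v eq with b Fin.≟ u | b Fin.≟ v
    ... | yes refl | yes refl = refl
    ... | yes _    | no _     = contradiction eq disj
    ... | no _     | yes _    = contradiction (sym eq) disj
    ... | no b≢u   | no b≢v   = Fin.punchOut-injective b≢u b≢v (Fin.↑ʳ-injective m _ _ eq)

    meet : a ↑ˡ k ≡ r b
    meet with b Fin.≟ b
    ... | yes _  = refl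
    ... | no b≢b = contradiction refl b≢b

    meet⁻ : ∀ u v → u ↑ˡ k ≡ r v → u ≡ a × v ≡ b
    meet⁻ u v eq with b Fin.≟ v
    ... | yes refl = Fin.↑ˡ-injective k _ _ eq , refl
    ... | no  _    = contradiction eq disj

    r-punchIn : ∀ j → r (punchIn b j) ≡ m ↑ʳ j
    r-punchIn j with b Fin.≟ punchIn b j
    ... | yes eq = contradiction (sym eq) (Fin.punchInᵢ≢i b j)
    ... | no  _  = cong (m ↑ʳ_) (trans (Fin.punchOut-cong b refl) (Fin.punchOut-punchIn b))

    cover : ∀ (P : Fin (m ℕ.+ k) → Set) → (∀ u → P (u ↑ˡ k)) → (∀ v → P (r v)) → ∀ c → P c
    cover P pl pr c = subst P (Fin.join-splitAt m k c) (go (splitAt m c))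
      where
      go : ∀ z → P (join m k z)
      go (inj₁ u) = pl u
      go (inj₂ j) = subst P (r-punchIn j) (pr (punchIn b j))

  quotient : ∀ n {s : Fin (suc n) → ℕ} (x y : ∀ i → Fin (s i)) → Quotient x y
  quotient zero {s} x y = record
    { size = s zero ; π = π ; surjective = λ c → (zero , c) , refl
    ; kernel = λ p q → mk⇔ (complete p q) (EqC.gfold isEquivalence π sound)
    ; injective = λ { zero _ _ eq → eq } }
    where
    π : ⨆ s → Fin (s zero)
    π (zero , u) = u

    complete : ∀ p q → π p ≡ π q → EqClosure (Glue x y) p q
    complete (zero , _) (zero , _) refl = ε

    sound : ∀ {p q} → Glue x y p q → π p ≡ π q
    sound (glue {zero} {zero} ())

  quotient (suc n) {s} x y = record
    { size = W.size ; π = π ; surjective = surjective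
    ; kernel = λ p q → mk⇔ (complete p q) (EqC.gfold isEquivalence π sound)
    ; injective = injective }
    where
    open Equivalence using (to; from)

    module Q = Quotient (quotient n (x ∘ suc) (y ∘ suc))
    module W = Wedge (wedge (y zero) (Q.π (zero , x (suc zero))))

    π : ⨆ s → Fin W.size
    π (zero  , u) = W.l u
    π (suc i , u) = W.r (Q.π (i , u))

    surjective : StrictlySurjective _≡_ π
    surjective = W.cover _ (λ u → (zero , u) , refl)
      λ v → let ((i , u) , eq) = Q.surjective v in (suc i , u) , cong W.r eq

    shift : ⨆ (s ∘ suc) → ⨆ s
    shift (i , u) = suc i , u

    lift : ∀ {p q} → EqClosure (Glue (x ∘ suc) (y ∘ suc)) p q →
           EqClosure (Glue x y) (shift p) (shift q)
    lift = EqC.gmap shift λ { (glue eq) → glue (cong suc eq) }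

    cross : ∀ u i v → W.l u ≡ W.r (Q.π (i , v)) →
            EqClosure (Glue x y) (zero , u) (suc i , v)
    cross u i v eq with W.meet⁻ eq
    ... | refl , eq′ = EqC.return (glue refl) ◅◅ lift (to (Q.kernel _ _) (sym eq′))

    complete : ∀ p q → π p ≡ π q → EqClosure (Glue x y) p q
    complete (zero  , u) (zero  , v) eq with W.l-inj eq
    ... | refl = ε
    complete (zero  , u) (suc j , v) eq = cross u j v eq
    complete (suc i , u) (zero  , v) eq = EqC.symmetric _ (cross v i u (sym eq))
    complete (suc i , u) (suc j , v) eq = lift (to (Q.kernel _ _) (W.r-inj eq))

    sound : ∀ {p q} → Glue x y p q → π p ≡ π q
    sound (glue {zero}  {suc zero} _)  = W.meet
    sound (glue {suc i} {suc j}    eq) =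
      cong W.r (from (Q.kernel _ _)
        (EqC.return (glue (ℕ.suc-injective eq))))

    injective : ∀ i u v → π (i , u) ≡ π (i , v) → u ≡ v
    injective zero    u v = W.l-inj
    injective (suc i) u v = Q.injective i u v ∘ W.r-inj

chain-exists : ∀ n .{{_ : NonZero n}} (G : Fin n → Graph) (x y : ∀ i → Vertex (G i)) →
               ∃[ C ] IsChain G x y C
chain-exists (suc n) G x y = C , record
  { π = π ; π-surjective = surjective ; π-kernel = kernel
  ; π-adj = λ _ _ → mk⇔ id id }
  where
  open Quotient (quotient n x y)

  C : Graph
  C = record
    { order = size
    ; Adj = λ c d → ∃[ i ] ∃[ u ] ∃[ v ]
        Graph.Adj (G i) u v × π (i , u) ≡ c × π (i , v) ≡ d
    ; adj? = λ c d → Fin.any? λ i → Fin.any? λ u → Fin.any? λ v →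
        Graph.adj? (G i) u v ×-dec (π (i , u) Fin.≟ c) ×-dec (π (i , v) Fin.≟ d)
    ; adj-sym = λ (i , u , v , e , p , q) → i , v , u , Graph.adj-sym (G i) e , q , p
    ; adj-irrefl = λ { refl (i , u , v , e , p , q) →
        Graph.adj-irrefl (G i) (injective i u v (trans p (sym q))) e }
    }

{-# OPTIONS --safe #-}

-- A super dominating set S amounts to a matching between the complement of S
-- and S in which every private neighbour w sees no other vertex outside S.
-- Hence γsp G is the order of G minus the maximum size ν G of a family of
-- pairs (l i , r i) with l i ~ r j exactly when i = j, and l i ≠ r j.
-- This condition is symmetric in l and r.
--
-- Let C arise from G and H by identifying a with b.  Every edge of C lies in
-- G or in H, so ν C ≤ ν G + ν H.  Conversely, after exchanging l and r where
-- necessary, a and b occur only as left ends in optimal matchings of G and H;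
-- dropping from one of them the pair at the cut vertex leaves two matchings
-- with a common extension to C, so ν G + ν H ≤ ν C + 1.  As the order of C is
-- one less than the sum of the orders, γsp G + γsp H - 1 ≤ γsp C ≤ γsp G + γsp H,
-- and a chain is an iterated identification of this kind.

module Submission where

open import Defs
open import Data.Bool.Base using (true; false)
open import Data.Empty using (⊥-elim)
open import Data.Fin.Base using (Fin; zero; suc; punchIn; splitAt; join)
open import Data.Fin.Permutation using (↔⇒≡)
import Data.Fin.Properties as Fin
open import Data.Fin.Subset using (Subset; _∈_; _∉_; _∩_; ∁; ⁅_⁆; ∣_∣)
open import Data.Fin.Subset.Properties
  using (⊆-antisym; x∈⁅x⁆; x∈⁅y⁆⇒x≡y; x∈p∩q⁺; x∈p∩q⁻; x∈∁p⇒x∉p; x∉p⇒x∈∁p;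
         x∉∁p⇒x∈p; ∣∁p∣≡n∸∣p∣; ∣p∣≤n)
open import Data.Nat.Base using (ℕ; zero; suc; _+_; _≤_; _∸_; NonZero; s≤s)
open import Data.Nat.Properties
open import Algebra.Properties.CommutativeSemigroup +-commutativeSemigroup
  using (interchange; x∙yz≈y∙xz)
open import Data.Product.Base using (∃-syntax; _×_; _,_; proj₁; proj₂)
open import Data.Sum.Base using (_⊎_; inj₁; inj₂; [_,_])
open import Data.Vec.Base using (tabulate; []; _∷_; here; there)
open import Data.Vec.Properties using ([]=⇒lookup; lookup⇒[]=; lookup∘tabulate)
open import Function.Base using (_∘_)
open import Function.Bundles using (mk⤖; module Equivalence)
open import Function.Construct.Composition using (_↔-∘_)
open import Function.Definitions using (Injective)
open import Function.Properties.Bijection using (⤖⇒↔)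
import Relation.Binary.Construct.Closure.Equivalence as EqC
open import Relation.Binary.PropositionalEquality hiding ([_])
open import Relation.Nullary using (¬_; Dec; yes; no; does; contradiction)
open import Relation.Nullary.Decidable using (dec-true)

open Graph using (order; Adj; adj?; adj-sym; adj-irrefl; N)
open Equivalence using (to; from)

-- Finite sets

∈-tabulate⁺ : ∀ {n} {P : Fin n → Set} (P? : ∀ i → Dec (P i)) {i} →
              P i → i ∈ tabulate (does ∘ P?)
∈-tabulate⁺ P? {i} p =
  lookup⇒[]= i _ (trans (lookup∘tabulate (does ∘ P?) i) (dec-true (P? i) p))

∈-tabulate⁻ : ∀ {n} {P : Fin n → Set} (P? : ∀ i → Dec (P i)) {i} →
              i ∈ tabulate (does ∘ P?) → P i
∈-tabulate⁻ P? {i} i∈ with P? i | trans (sym (lookup∘tabulate (does ∘ P?) i)) ([]=⇒lookup i∈)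
... | yes p | _ = p

SubFamily : ∀ {K} → (Fin K → Set) → ℕ → Set
SubFamily {K} P J = ∃[ f ] Injective {A = Fin J} {B = Fin K} _≡_ _≡_ f × (∀ j → P (f j))

sub-empty : (P : Fin 0 → Set) → SubFamily P 0
sub-empty P = (λ ()) , (λ {i} → contradiction i λ ()) , λ ()

sub-cons : ∀ {K J} (P : Fin (suc K) → Set) → P zero → SubFamily (P ∘ suc) J → SubFamily P (suc J)
sub-cons {K} {J} P p (f , f-inj , Pf) = g , g-inj , Pg
  where
  g : Fin (suc J) → Fin (suc K)
  g zero    = zero
  g (suc j) = suc (f j)

  g-inj : Injective _≡_ _≡_ g
  g-inj {zero}  {zero}  _  = refl
  g-inj {suc i} {suc j} eq = cong suc (f-inj (Fin.suc-injective eq))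

  Pg : ∀ j → P (g j)
  Pg zero    = p
  Pg (suc j) = Pf j

sub-skip : ∀ {K J} (P : Fin (suc K) → Set) → SubFamily (P ∘ suc) J → SubFamily P J
sub-skip P (f , f-inj , Pf) = suc ∘ f , f-inj ∘ Fin.suc-injective , Pf

-- The disjunction sends each index to exactly one side, so the sizes add up to `K` even where `P`
-- and `Q` overlap.
partition : ∀ {K} {P Q : Fin K → Set} → (∀ k → P k ⊎ Q k) →
            ∃[ I ] ∃[ J ] I + J ≡ K × SubFamily P I × SubFamily Q J
partition {zero}  {P} {Q} _  = 0 , 0 , refl , sub-empty P , sub-empty Q
partition {suc K} {P} {Q} PQ with PQ zero | partition (PQ ∘ suc)
... | inj₁ p | I , J , refl , F , F′ = suc I , J , refl , sub-cons P p F , sub-skip Q F′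
... | inj₂ q | I , J , refl , F , F′ = I , suc J , +-suc I J , sub-skip P F , sub-cons Q q F′

enumerate : ∀ {n} (S : Subset n) → SubFamily (_∈ S) ∣ S ∣
enumerate []          = sub-empty (_∈ [])
enumerate (true ∷ S)  with enumerate S
... | f , f-inj , f∈S = sub-cons (_∈ true ∷ S) here (f , f-inj , there ∘ f∈S)
enumerate (false ∷ S) with enumerate S
... | f , f-inj , f∈S = sub-skip (_∈ false ∷ S) (f , f-inj , there ∘ f∈S)

splitAt-injective : ∀ m {n} → Injective _≡_ _≡_ (splitAt m {n})
splitAt-injective m {n} {i} {j} eq =
  trans (sym (Fin.join-splitAt m n i)) (trans (cong (join m n) eq) (Fin.join-splitAt m n j))

[,]-injective : ∀ {A B C : Set} {f : A → C} {g : B → C} →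
                Injective _≡_ _≡_ f → Injective _≡_ _≡_ g → (∀ a b → f a ≢ g b) →
                Injective _≡_ _≡_ [ f , g ]
[,]-injective f-inj g-inj f≢g {inj₁ _} {inj₁ _} eq = cong inj₁ (f-inj eq)
[,]-injective f-inj g-inj f≢g {inj₁ _} {inj₂ _} eq = contradiction eq (f≢g _ _)
[,]-injective f-inj g-inj f≢g {inj₂ _} {inj₁ _} eq = contradiction (sym eq) (f≢g _ _)
[,]-injective f-inj g-inj f≢g {inj₂ _} {inj₂ _} eq = cong inj₂ (g-inj eq)

-- The image of `f` and an enumeration of `S` are disjoint, so together they inject into `Fin n`.
injective∉⇒≤ : ∀ {n k} (S : Subset n) (f : Fin k → Fin n) →
               Injective _≡_ _≡_ f → (∀ i → f i ∉ S) → k + ∣ S ∣ ≤ n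
injective∉⇒≤ {k = k} S f f-inj f∉S with enumerate S
... | g , g-inj , g∈S = Fin.injective⇒≤ {f = [ f , g ] ∘ splitAt k}
  (splitAt-injective k ∘ [,]-injective f-inj g-inj
    λ i j eq → f∉S i (subst (_∈ S) (sym eq) (g∈S j)))

-- Matchings

-- Adjacency among left ends, or among right ends, is unrestricted. The index type is arbitrary so
-- that a union of two matchings can be indexed by a sum type.
record Matching (G : Graph) (I : Set) : Set where
  field
    left right : I → Vertex G
    matched    : ∀ i → Adj G (left i) (right i)
    separated  : ∀ i j → Adj G (left i) (right j) → i ≡ j
    disjoint   : ∀ i j → left i ≢ right j

  -- Equal left ends share the neighbour `right j`, so `separated` identifies their indices.
  left-injective : Injective _≡_ _≡_ left
  left-injective {i} {j} eq =
    separated i j (subst (λ u → Adj G u (right j)) (sym eq) (matched j))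

open Matching

swap : ∀ {G I} → Matching G I → Matching G I
swap {G} M = record
  { left = right M ; right = left M
  ; matched   = adj-sym G ∘ matched M
  ; separated = λ i j e → sym (separated M j i (adj-sym G e))
  ; disjoint  = λ i j eq → disjoint M j i (sym eq) }

reindex : ∀ {G I J} (f : J → I) → Injective _≡_ _≡_ f → Matching G I → Matching G J
reindex f f-inj M = record
  { left = left M ∘ f ; right = right M ∘ f
  ; matched   = matched M ∘ f
  ; separated = λ i j e → f-inj (separated M (f i) (f j) e)
  ; disjoint  = λ i j → disjoint M (f i) (f j) }

-- Super dominating sets as matchings

∈-N⁺ : ∀ G {u v} → Adj G v u → u ∈ N G v
∈-N⁺ G {v = v} = ∈-tabulate⁺ (adj? G v)

∈-N⁻ : ∀ G {u v} → u ∈ N G v → Adj G v u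
∈-N⁻ G {v = v} = ∈-tabulate⁻ (adj? G v)

-- Left ends enumerate the complement of `S`, right ends are their private neighbours. A left end
-- adjacent to `w j` lies in the singleton `N (w j) ∩ ∁ S`, which gives `separated`.
superDominating⇒matching : ∀ G S → SuperDominating G S → Matching G (Fin ∣ ∁ S ∣)
superDominating⇒matching G S (_ , private-nbr) = record
  { left = f ; right = w
  ; matched   = λ i → adj-sym G (∈-N⁻ G (proj₁ (x∈p∩q⁻ _ _
      (subst (f i ∈_) (sym (N-w i)) (x∈⁅x⁆ (f i))))))
  ; separated = λ i j e → f-inj (x∈⁅y⁆⇒x≡y (f j)
      (subst (f i ∈_) (N-w j) (x∈p∩q⁺ (∈-N⁺ G (adj-sym G e) , f∈∁S i))))
  ; disjoint  = λ i j eq → f∉S i (subst (_∈ S) (sym eq) (proj₁ (proj₂ (private-nbr (f j) (f∉S j))))) }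
  where
  f     = proj₁ (enumerate (∁ S))
  f-inj = proj₁ (proj₂ (enumerate (∁ S)))
  f∈∁S  = proj₂ (proj₂ (enumerate (∁ S)))

  f∉S : ∀ i → f i ∉ S
  f∉S i = x∈∁p⇒x∉p (f∈∁S i)

  w : Fin ∣ ∁ S ∣ → Vertex G
  w i = proj₁ (private-nbr (f i) (f∉S i))

  N-w : ∀ i → N G (w i) ∩ ∁ S ≡ ⁅ f i ⁆
  N-w i = proj₂ (proj₂ (private-nbr (f i) (f∉S i)))

module _ {G K} (M : Matching G (Fin K)) where
  private
    isLeft? : ∀ u → Dec (∃[ i ] left M i ≡ u)
    isLeft? u = Fin.any? λ i → left M i Fin.≟ u

    leftSet : Subset (order G)
    leftSet = tabulate (does ∘ isLeft?)

    left∈∁ : ∀ i → left M i ∉ ∁ leftSet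
    left∈∁ i l∈ = x∈∁p⇒x∉p l∈ (∈-tabulate⁺ isLeft? (i , refl))

    right∈∁ : ∀ i → right M i ∈ ∁ leftSet
    right∈∁ i = x∉p⇒x∈∁p λ r∈ →
      let (j , eq) = ∈-tabulate⁻ isLeft? r∈ in disjoint M j i eq

    ∉∁⇒left : ∀ {u} → u ∉ ∁ leftSet → ∃[ i ] left M i ≡ u
    ∉∁⇒left u∉ = ∈-tabulate⁻ isLeft? (x∉∁p⇒x∈p u∉)

    private-right : ∀ i → N G (right M i) ∩ ∁ (∁ leftSet) ≡ ⁅ left M i ⁆
    private-right i = ⊆-antisym
      (λ u∈ → let (u∈N , u∈∁∁) = x∈p∩q⁻ _ _ u∈ in only (∈-N⁻ G u∈N) (∉∁⇒left (x∈∁p⇒x∉p u∈∁∁)))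
      (λ u∈ → subst (_∈ _) (sym (x∈⁅y⁆⇒x≡y _ u∈))
        (x∈p∩q⁺ (∈-N⁺ G (adj-sym G (matched M i)) , x∉p⇒x∈∁p (left∈∁ i))))
      where
      only : ∀ {u} → Adj G (right M i) u → ∃[ j ] left M j ≡ u → u ∈ ⁅ left M i ⁆
      only e (j , refl) with separated M j i (adj-sym G e)
      ... | refl = x∈⁅x⁆ _

  -- The complement of the left ends contains all right ends by `disjoint`, and by `separated` the
  -- only left end that `right M i` sees is its partner.
  matching⇒superDominating : SuperDominating G (∁ leftSet)
  matching⇒superDominating = dominating , super
    where
    dominating : Dominating G (∁ leftSet)
    dominating u u∉ with ∉∁⇒left u∉
    ... | i , refl = right M i , right∈∁ i , matched M i

    super : ∀ u → u ∉ ∁ leftSet → ∃[ w ] w ∈ ∁ leftSet × N G w ∩ ∁ (∁ leftSet) ≡ ⁅ u ⁆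
    super u u∉ with ∉∁⇒left u∉
    ... | i , refl = right M i , right∈∁ i , private-right i

  -- The left ends are `K` distinct vertices outside a super dominating set.
  matching-bound : K + γsp G ≤ order G
  matching-bound = ≤-trans
    (+-monoʳ-≤ K (proj₂ (γsp-isMinimum G) _ matching⇒superDominating))
    (injective∉⇒≤ (∁ leftSet) (left M) (left-injective M) left∈∁)

-- A minimum super dominating set yields as many pairs as `matching-bound` allows.
maximum-matching : ∀ G → ∃[ K ] Matching G (Fin K) × K + γsp G ≡ order G
maximum-matching G with γsp-isMinimum G
... | (S , sd , eq) , _ = ∣ ∁ S ∣ , superDominating⇒matching G S sd ,
  trans (cong₂ _+_ (∣∁p∣≡n∸∣p∣ S) (sym eq)) (m∸n+n≡m (∣p∣≤n S))

-- Matchings that avoid a vertex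

Avoids : ∀ {G I} → Matching G I → Vertex G → Set
Avoids M v = ∀ i → left M i ≢ v × right M i ≢ v

-- If `v` is a right end, then by `disjoint` it is no left end, and exchanging the two sides helps.
orient : ∀ {G K} → Matching G (Fin K) → (v : Vertex G) →
         ∃[ M ] (∀ (i : Fin K) → right {G} M i ≢ v)
orient M v with Fin.any? (λ i → right M i Fin.≟ v)
... | yes (i , eq) = swap M , λ j eq′ → disjoint M j i (trans eq′ (sym eq))
... | no  none     = M , λ j eq → none (j , eq)

remove : ∀ {G K} → Fin (suc K) → Matching G (Fin (suc K)) → Matching G (Fin K)
remove k = reindex (punchIn k) (Fin.punchIn-injective k _ _)

remove-avoids : ∀ {G K} (M : Matching G (Fin (suc K))) {v} → (∀ i → right M i ≢ v) →
                ∀ k → left M k ≡ v → Avoids (remove k M) v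
remove-avoids M r≢v k eq i =
  (λ eq′ → Fin.punchInᵢ≢i k i (left-injective M (trans eq′ (sym eq)))) , r≢v _

-- Since left ends are distinct, at most one pair meets `v`; dropping it loses at most one.
avoid : ∀ {G K} (M : Matching G (Fin K)) {v} → (∀ i → right M i ≢ v) →
        ∃[ J ] K ≤ suc J × ∃[ M′ ] Avoids {G} {Fin J} M′ v
avoid {K = K} M {v} r≢v with Fin.any? (λ i → left M i Fin.≟ v)
... | no none = K , n≤1+n K , M , λ i → (λ eq → none (i , eq)) , r≢v i
avoid {K = suc J} M r≢v | yes (k , eq) = J , ≤-refl , remove k M , remove-avoids M r≢v k eq

-- Identifying two vertices

-- Described by its two embeddings rather than by a construction, so that it applies to every graph
-- satisfying `IsChain`.
record IsWedge (G H : Graph) (a : Vertex G) (b : Vertex H) (C : Graph) : Set where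
  field
    l     : Vertex G → Vertex C
    r     : Vertex H → Vertex C
    l-inj : Injective _≡_ _≡_ l
    r-inj : Injective _≡_ _≡_ r
    meet  : l a ≡ r b
    meet⁻ : ∀ {u v} → l u ≡ r v → u ≡ a × v ≡ b
    cover : ∀ c → (∃[ u ] l u ≡ c) ⊎ (∃[ v ] r v ≡ c)
    l-adj : ∀ {u v} → Adj G u v → Adj C (l u) (l v)
    r-adj : ∀ {u v} → Adj H u v → Adj C (r u) (r v)
    adj⁻  : ∀ {c d} → Adj C c d →
            (∃[ u ] ∃[ v ] Adj G u v × l u ≡ c × l v ≡ d) ⊎
            (∃[ u ] ∃[ v ] Adj H u v × r u ≡ c × r v ≡ d)

-- As `h` preserves edges, an unwanted adjacency or coincidence of lifted ends would map to one in
-- `M`.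
pull : ∀ {G C I} (h : Vertex G → Vertex C) → (∀ {u v} → Adj G u v → Adj C (h u) (h v)) →
       (M : Matching C I) →
       (∀ i → ∃[ u ] ∃[ v ] Adj G u v × h u ≡ left M i × h v ≡ right M i) → Matching G I
pull {G} {C} h h-adj M e = record
  { left = λ i → proj₁ (e i) ; right = λ i → proj₁ (proj₂ (e i))
  ; matched   = λ i → proj₁ (proj₂ (proj₂ (e i)))
  ; separated = λ i j uv → separated M i j (subst₂ (Adj C) (left-eq i) (right-eq j) (h-adj uv))
  ; disjoint  = λ i j eq → disjoint M i j (trans (sym (left-eq i)) (trans (cong h eq) (right-eq j))) }
  where
  left-eq : ∀ i → h (proj₁ (e i)) ≡ left M i
  left-eq i = proj₁ (proj₂ (proj₂ (proj₂ (e i))))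

  right-eq : ∀ i → h (proj₁ (proj₂ (e i))) ≡ right M i
  right-eq i = proj₂ (proj₂ (proj₂ (proj₂ (e i))))

module _ {G H a b C} (W : IsWedge G H a b C) where
  open IsWedge W

  -- An edge coming from `H` would have both ends at the cut vertex and so be a loop at `b`.
  l-adj⁻ : ∀ {u v} → Adj C (l u) (l v) → Adj G u v
  l-adj⁻ e with adj⁻ e
  ... | inj₁ (_ , _ , e′ , p , q) = subst₂ (Adj G) (l-inj p) (l-inj q) e′
  ... | inj₂ (_ , _ , e′ , p , q) = contradiction e′
    (adj-irrefl H (trans (proj₂ (meet⁻ (sym p))) (sym (proj₂ (meet⁻ (sym q))))))

  r-adj⁻ : ∀ {u v} → Adj C (r u) (r v) → Adj H u v
  r-adj⁻ e with adj⁻ e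
  ... | inj₂ (_ , _ , e′ , p , q) = subst₂ (Adj H) (r-inj p) (r-inj q) e′
  ... | inj₁ (_ , _ , e′ , p , q) = contradiction e′
    (adj-irrefl G (trans (proj₁ (meet⁻ p)) (sym (proj₁ (meet⁻ q)))))

  -- Such an edge cannot come from `G`, as `r v` is not the cut vertex; hence it comes from `H`, and
  -- `l u` must be the cut vertex.
  cross-adj⁻ : ∀ {u v} → v ≢ b → Adj C (l u) (r v) → u ≡ a × Adj H b v
  cross-adj⁻ v≢b e with adj⁻ e
  ... | inj₁ (_ , _ , e′ , p , q) = contradiction (proj₂ (meet⁻ q)) v≢b
  ... | inj₂ (_ , _ , e′ , p , q) with meet⁻ (sym p)
  ...   | u≡a , refl = u≡a , subst (Adj H b) (r-inj q) e′

  -- Once `M′` avoids `b`, the two matchings can interfere only along an edge from an end of `M` at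
  -- `a` to an `H`-neighbour of `b`; the last two hypotheses exclude these.
  union : ∀ {I J} (M : Matching G I) (M′ : Matching H J) → Avoids M′ b →
          (∀ i j → left M i ≡ a → ¬ Adj H b (right M′ j)) →
          (∀ i j → right M i ≡ a → ¬ Adj H b (left  M′ j)) →
          Matching C (I ⊎ J)
  union M M′ avoids sepˡ sepʳ = record
    { left  = [ l ∘ left M , r ∘ left M′ ]
    ; right = [ l ∘ right M , r ∘ right M′ ]
    ; matched = λ { (inj₁ i) → l-adj (matched M i) ; (inj₂ j) → r-adj (matched M′ j) }
    ; separated = λ
      { (inj₁ i) (inj₁ j) e → cong inj₁ (separated M i j (l-adj⁻ e))
      ; (inj₁ i) (inj₂ j) e → let (eq , e′) = cross-adj⁻ (proj₂ (avoids j)) e in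
          ⊥-elim (sepˡ i j eq e′)
      ; (inj₂ i) (inj₁ j) e → let (eq , e′) = cross-adj⁻ (proj₁ (avoids i)) (adj-sym C e) in
          ⊥-elim (sepʳ j i eq e′)
      ; (inj₂ i) (inj₂ j) e → cong inj₂ (separated M′ i j (r-adj⁻ e)) }
    ; disjoint = λ
      { (inj₁ i) (inj₁ j) eq → disjoint M i j (l-inj eq)
      ; (inj₁ i) (inj₂ j) eq → proj₂ (avoids j) (proj₂ (meet⁻ eq))
      ; (inj₂ i) (inj₁ j) eq → proj₁ (avoids i) (proj₂ (meet⁻ (sym eq)))
      ; (inj₂ i) (inj₂ j) eq → disjoint M′ i j (r-inj eq) } }

  join-matchings : ∀ {I J} → Matching G (Fin I) → Matching H (Fin J) →
                   ∃[ K ] I + J ≤ suc K × Matching C (Fin K)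
  join-matchings {I} {J} M₀ M′₀ with orient M₀ a | orient M′₀ b
  ... | M , r≢a | M′ , r′≢b with Fin.any? (λ j → left M′ j Fin.≟ b)
  -- Here `M′` already avoids `b`; dropping from `M` a possible pair at `a` keeps both matchings off
  -- the cut vertex.
  join-matchings {I} {J} _ _ | M , r≢a | M′ , r′≢b | no none with avoid M r≢a
  ... | K , I≤1+K , M⁻ , avoids =
    K + J , +-monoˡ-≤ J I≤1+K , reindex (splitAt K) (splitAt-injective K)
      (union M⁻ M′ (λ j → (λ eq → none (j , eq)) , r′≢b j)
        (λ i _ eq → contradiction eq (proj₁ (avoids i)))
        (λ i _ eq → contradiction eq (proj₂ (avoids i))))
  join-matchings {I} {suc J} _ _ | M , r≢a | M′ , r′≢b | yes (k , refl) =
    I + J , ≤-reflexive (+-suc I J) , reindex (splitAt I) (splitAt-injective I)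
      (union M (remove k M′) (remove-avoids M′ r′≢b k refl)
        -- The whole of `M` is kept, possibly with a left end at `a`. The removed pair `k` had left
        -- end `b`, so `separated` shows that `b` sees no right end of the remaining pairs.
        (λ i j _ e → Fin.punchInᵢ≢i k j (sym (separated M′ k (punchIn k j) e)))
        (λ i _ eq → contradiction eq (r≢a i)))

  split-matching : ∀ {K} → Matching C (Fin K) →
                   ∃[ I ] ∃[ J ] I + J ≡ K × Matching G (Fin I) × Matching H (Fin J)
  split-matching M with partition (λ k → adj⁻ (matched M k))
  ... | I , J , eq , (f , f-inj , Pf) , (g , g-inj , Qg) =
    I , J , eq , pull l l-adj (reindex f f-inj M) Pf , pull r r-adj (reindex g g-inj M) Qg

  wedge-order : order G + order H ≡ suc (order C)
  wedge-order = ↔⇒≡ (⤖⇒↔ (mk⤖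
    ([,]-injective (l-inj ∘ Fin.suc-injective) r⁺-inj l≢r⁺ , surjective)) ↔-∘ Fin.+↔⊎)
    where
    -- zero accounts for the vertex lost by identifying a with b.
    r⁺ : Vertex H → Fin (suc (order C))
    r⁺ v with v Fin.≟ b
    ... | yes _ = zero
    ... | no  _ = suc (r v)

    r⁺-inj : Injective _≡_ _≡_ r⁺
    r⁺-inj {u} {v} eq with u Fin.≟ b | v Fin.≟ b
    ... | yes refl | yes refl = refl
    ... | no  _    | no _     = r-inj (Fin.suc-injective eq)

    l≢r⁺ : ∀ u v → suc (l u) ≢ r⁺ v
    l≢r⁺ u v eq with v Fin.≟ b
    ... | no v≢b = v≢b (proj₂ (meet⁻ (Fin.suc-injective eq)))

    r⁺-b : r⁺ b ≡ zero
    r⁺-b with b Fin.≟ b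
    ... | yes _  = refl
    ... | no b≢b = contradiction refl b≢b

    r⁺-≢b : ∀ {v} → v ≢ b → r⁺ v ≡ suc (r v)
    r⁺-≢b {v} v≢b with v Fin.≟ b
    ... | yes v≡b = contradiction v≡b v≢b
    ... | no  _   = refl

    hit : ∀ c → ∃[ p ] [ suc ∘ l , r⁺ ] p ≡ c
    hit zero = inj₂ b , r⁺-b
    hit (suc c) with cover c
    ... | inj₁ (u , refl) = inj₁ u , refl
    ... | inj₂ (v , refl) with v Fin.≟ b
    -- The cut vertex is reached through `G`, since `r⁺` spends `b` on `zero`.
    ...   | yes refl = inj₁ a , cong suc meet
    ...   | no  v≢b  = inj₂ v , r⁺-≢b v≢b

    surjective : ∀ c → ∃[ p ] (∀ {q} → q ≡ p → [ suc ∘ l , r⁺ ] q ≡ c)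
    surjective c = let (p , eq) = hit c in p , λ { refl → eq }

  wedge-lower : γsp G + γsp H ≤ suc (γsp C)
  wedge-lower with maximum-matching C
  ... | K , M , K+γ≡ with split-matching M
  ...   | I , J , refl , M₁ , M₂ = +-cancelˡ-≤ (I + J) _ _ (begin
    (I + J) + (γsp G + γsp H) ≡⟨ interchange I J (γsp G) (γsp H) ⟩
    (I + γsp G) + (J + γsp H) ≤⟨ +-mono-≤ (matching-bound M₁) (matching-bound M₂) ⟩
    order G + order H         ≡⟨ wedge-order ⟩
    suc (order C)             ≡⟨ cong suc K+γ≡ ⟨
    suc ((I + J) + γsp C)     ≡⟨ +-suc (I + J) (γsp C) ⟨
    (I + J) + suc (γsp C)     ∎)
    where
    open ≤-Reasoning

  -- The pair that `join-matchings` may lose is offset by the vertex lost in the identification.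
  wedge-upper : γsp C ≤ γsp G + γsp H
  wedge-upper with maximum-matching G | maximum-matching H
  ... | I , M₁ , I+γ≡ | J , M₂ , J+γ≡ with join-matchings M₁ M₂
  ...   | K , I+J≤1+K , M = +-cancelˡ-≤ (I + J) _ _ (begin
    (I + J) + γsp C           ≤⟨ +-monoˡ-≤ (γsp C) I+J≤1+K ⟩
    suc (K + γsp C)           ≤⟨ s≤s (matching-bound M) ⟩
    suc (order C)             ≡⟨ wedge-order ⟨
    order G + order H         ≡⟨ cong₂ _+_ I+γ≡ J+γ≡ ⟨
    (I + γsp G) + (J + γsp H) ≡⟨ interchange I (γsp G) J (γsp H) ⟩
    (I + J) + (γsp G + γsp H) ∎)
    where
    open ≤-Reasoning

-- Chains

-- A maximum matching of `C` lifts to `G` with the same size. Used in both directions, this gives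
-- invariance under isomorphism.
edge-surjection-≤ : ∀ G C (h : Vertex G → Vertex C) →
  (∀ {u v} → Adj G u v → Adj C (h u) (h v)) →
  (∀ {c d} → Adj C c d → ∃[ u ] ∃[ v ] Adj G u v × h u ≡ c × h v ≡ d) →
  order G ≤ order C → γsp G ≤ γsp C
edge-surjection-≤ G C h h-adj h-adj⁻ G≤C with maximum-matching C
... | K , M , K+γ≡ = +-cancelˡ-≤ K _ _ (begin
  K + γsp G ≤⟨ matching-bound (pull {G} h h-adj M (h-adj⁻ ∘ matched M)) ⟩
  order G   ≤⟨ G≤C ⟩
  order C   ≡⟨ K+γ≡ ⟨
  K + γsp C ∎)
  where open ≤-Reasoning

module _ {G : Fin 1 → Graph} {x y : ∀ i → Vertex (G i)} {C} (chain : IsChain G x y C) where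
  open IsChain chain

  singleton-γsp : γsp C ≡ γsp (G zero)
  singleton-γsp = ≤-antisym
    (edge-surjection-≤ C (G zero) h⁻ h⁻-adj h-lift (Fin.injective⇒≤ h⁻-inj))
    (edge-surjection-≤ (G zero) C h h-adj h⁻-lift (Fin.injective⇒≤ h-inj))
    where
    h : Vertex (G zero) → Vertex C
    h u = π (zero , u)

    unique : ⨆ (order ∘ G) → Vertex (G zero)
    unique (zero , u) = u

    h-inj : Injective _≡_ _≡_ h
    -- With a single index no gluing exists, so every class is a singleton.
    h-inj eq = EqC.gfold isEquivalence unique (λ { (glue {zero} {zero} ()) }) (to (π-kernel _ _) eq)

    h⁻ : Vertex C → Vertex (G zero)
    h⁻ c = unique (proj₁ (π-surjective c))

    h∘h⁻ : ∀ c → h (h⁻ c) ≡ c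
    h∘h⁻ c with π-surjective c
    ... | (zero , u) , eq = eq

    h⁻∘h : ∀ u → h⁻ (h u) ≡ u
    h⁻∘h u = h-inj (h∘h⁻ (h u))

    h⁻-inj : Injective _≡_ _≡_ h⁻
    h⁻-inj {c} {d} eq = trans (sym (h∘h⁻ c)) (trans (cong h eq) (h∘h⁻ d))

    h-adj : ∀ {u v} → Adj (G zero) u v → Adj C (h u) (h v)
    h-adj e = from (π-adj _ _) (zero , _ , _ , e , refl , refl)

    h⁻-lift : ∀ {c d} → Adj C c d → ∃[ u ] ∃[ v ] Adj (G zero) u v × h u ≡ c × h v ≡ d
    h⁻-lift e with to (π-adj _ _) e
    ... | zero , lifted = lifted

    h⁻-adj : ∀ {c d} → Adj C c d → Adj (G zero) (h⁻ c) (h⁻ d)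
    h⁻-adj e with h⁻-lift e
    ... | u , v , e′ , refl , refl = subst₂ (Adj (G zero)) (sym (h⁻∘h u)) (sym (h⁻∘h v)) e′

    h-lift : ∀ {u v} → Adj (G zero) u v → ∃[ c ] ∃[ d ] Adj C c d × h⁻ c ≡ u × h⁻ d ≡ v
    h-lift e = _ , _ , h-adj e , h⁻∘h _ , h⁻∘h _

module _ {n} {G : Fin (suc (suc n)) → Graph} {x y : ∀ i → Vertex (G i)} {C C′ : Graph}
         (chain : IsChain G x y C)
         (tail : IsChain (G ∘ suc) (x ∘ suc) (y ∘ suc) C′) where
  private
    open IsChain chain
    module T = IsChain tail

    s : Fin (suc (suc n)) → ℕ
    s = order ∘ G

    shift : ⨆ (s ∘ suc) → ⨆ s
    shift (i , u) = suc i , u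

    b : Vertex C′
    b = T.π (zero , x (suc zero))

    -- The retractions onto the two parts separate the classes of EqClosure (Glue x y).
    toHead : ⨆ s → Vertex (G zero)
    toHead (zero  , u) = u
    toHead (suc i , u) = y zero

    toTail : ⨆ s → Vertex C′
    toTail (zero  , u) = b
    toTail (suc i , u) = T.π (i , u)

    toHead-resp : ∀ p q → π p ≡ π q → toHead p ≡ toHead q
    toHead-resp p q eq = EqC.gfold isEquivalence toHead
      (λ { (glue {zero} {suc _} _) → refl ; (glue {suc _} {suc _} _) → refl })
      (to (π-kernel _ _) eq)

    toTail-resp : ∀ p q → π p ≡ π q → toTail p ≡ toTail q
    toTail-resp p q eq = EqC.gfold isEquivalence toTail
      (λ { (glue {zero} {suc zero} _) → refl
         ; (glue {suc _} {suc _} eq) → from (T.π-kernel _ _) (EqC.return (glue (suc-injective eq))) })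
      (to (π-kernel _ _) eq)

    shift-resp : ∀ p q → T.π p ≡ T.π q → π (shift p) ≡ π (shift q)
    shift-resp p q eq = from (π-kernel _ _)
      (EqC.gmap shift (λ { (glue eq) → glue (cong suc eq) }) (to (T.π-kernel _ _) eq))

    r : Vertex C′ → Vertex C
    r c = π (shift (proj₁ (T.π-surjective c)))

    -- The representative chosen in `r` does not matter.
    r-π : ∀ p → r (T.π p) ≡ π (shift p)
    r-π p = shift-resp _ p (proj₂ (T.π-surjective (T.π p)))

    toTail-r : ∀ c p → r c ≡ π p → c ≡ toTail p
    toTail-r c p eq = trans (sym (proj₂ (T.π-surjective c))) (toTail-resp _ p eq)

  chain-isWedge : IsWedge (G zero) C′ (y zero) b C
  chain-isWedge = record
    { l     = λ u → π (zero , u)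
    ; r     = r
    ; l-inj = toHead-resp _ _
    ; r-inj = λ {c} {d} eq → trans (toTail-r c _ eq) (proj₂ (T.π-surjective d))
    ; meet  = trans (from (π-kernel _ _) (EqC.return (glue refl))) (sym (r-π _))
    -- Both retractions are applied to the common vertex: one collapses the tail to `y zero`, the
    -- other collapses the head to `b`.
    ; meet⁻ = λ {u} {c} eq → toHead-resp _ _ eq , toTail-r c (zero , u) (sym eq)
    ; cover = cover
    ; l-adj = λ e → from (π-adj _ _) (zero , _ , _ , e , refl , refl)
    ; r-adj = r-adj
    ; adj⁻  = adj⁻ }
    where
    cover : ∀ c → (∃[ u ] π (zero , u) ≡ c) ⊎ (∃[ v ] r v ≡ c)
    cover c with π-surjective c
    ... | (zero  , u) , eq = inj₁ (u , eq)
    ... | (suc i , u) , eq = inj₂ (T.π (i , u) , trans (r-π _) eq)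

    r-adj : ∀ {c d} → Adj C′ c d → Adj C (r c) (r d)
    r-adj e with to (T.π-adj _ _) e
    ... | i , u , v , e′ , refl , refl =
      from (π-adj _ _) (suc i , u , v , e′ , sym (r-π _) , sym (r-π _))

    adj⁻ : ∀ {c d} → Adj C c d →
           (∃[ u ] ∃[ v ] Adj (G zero) u v × π (zero , u) ≡ c × π (zero , v) ≡ d) ⊎
           (∃[ u ] ∃[ v ] Adj C′ u v × r u ≡ c × r v ≡ d)
    adj⁻ e with to (π-adj _ _) e
    ... | zero  , lifted = inj₁ lifted
    ... | suc i , u , v , e′ , p , q = inj₂
      ( _ , _ , from (T.π-adj _ _) (i , u , v , e′ , refl , refl)
      , trans (r-π _) p , trans (r-π _) q )

-- Induction on the tail of the chain. The lower bound loses one per identification, and `suc n`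
-- graphs need only `n` of them.
chain-bounds : ∀ n (G : Fin (suc n) → Graph) (x y : ∀ i → Vertex (G i)) C → IsChain G x y C →
               (∑[ i < suc n ] γsp (G i) ≤ n + γsp C) × (γsp C ≤ ∑[ i < suc n ] γsp (G i))
chain-bounds zero G x y C chain =
  ≤-reflexive (sym eq) , ≤-reflexive eq
  where
  eq : γsp C ≡ γsp (G zero) + 0
  eq = trans (singleton-γsp chain) (sym (+-identityʳ _))
chain-bounds (suc n) G x y C chain
  -- `C` is given only through `IsChain`, so a chain of the remaining graphs has to be constructed.
  with chain-exists (suc n) (G ∘ suc) (x ∘ suc) (y ∘ suc)
... | C′ , tail with chain-bounds n (G ∘ suc) (x ∘ suc) (y ∘ suc) C′ tail
...   | lower , upper = (begin
    γsp (G zero) + ∑[ i < suc n ] γsp (G (suc i)) ≤⟨ +-monoʳ-≤ (γsp (G zero)) lower ⟩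
    γsp (G zero) + (n + γsp C′)                   ≡⟨ x∙yz≈y∙xz (γsp (G zero)) n (γsp C′) ⟩
    n + (γsp (G zero) + γsp C′)                   ≤⟨ +-monoʳ-≤ n (wedge-lower W) ⟩
    n + suc (γsp C)                               ≡⟨ +-suc n (γsp C) ⟩
    suc n + γsp C                                 ∎)
  , ≤-trans (wedge-upper W) (+-monoʳ-≤ (γsp (G zero)) upper)
  where
  open ≤-Reasoning
  W = chain-isWedge chain tail

corollary3p4 : (n : ℕ) .{{_ : NonZero n}} →
    (G : Fin n → Graph) → (∀ i → Connected (G i)) →
    (x y : ∀ i → Vertex (G i)) →
    (C : Graph) → IsChain G x y C →
    ((∑[ i < n ] γsp (G i)) ∸ n ≤ γsp C) × (γsp C ≤ ∑[ i < n ] γsp (G i))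
corollary3p4 (suc n) G _ x y C chain with chain-bounds n G x y C chain
-- The lower bound is weakened from the number of identifications to the number of graphs.
... | lower , upper = m≤n+o⇒m∸n≤o _ (suc n) (m≤n⇒m≤1+n lower) , upper
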